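{- Let $\mathbb{P}$ be a $\sigma$-finite-cc forcing notion, and let $T$ be a non-special tree of height $\omega_1$ (of arbitrary size) without cofinal branches. Then $T$ is non-special in the generic extension $V[\mathbb{P}]$ (i.e. $T$ remains non-special in every extension of $V$ by a $\mathbb{P}$-generic filter).
   Context: A forcing notion $\mathbb{P}$ is \emph{$\sigma$-finite-cc} if there are subsets $\mathbb{P}_k\subseteq\mathbb{P}$ for $k<\omega$ such that (i) $\bigcup_{k<\omega}\mathbb{P}_k=\mathbb{P}$, and (ii) for every $k<\omega$ there is $n_k<\omega$ such that every antichain $A\subseteq\mathbb{P}_k$ (set of pairwise incompatible conditions) has size at most $n_k$. A tree $(T,<_T)$ of height $\omega_1$ is \emph{special} if there is a function $f:T\to\omega$ that is injective on chains, i.e. $s<_T t$ implies $f(s)\neq f(t)$; equivalently, $T$ is a union of at most countably many antichains. A cofinal branch of $T$ is a chain meeting every level of $T$. -}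

module Defs where

open import Data.Bool.Base using (Bool; true; false; if_then_else_)
open import Data.Empty using (⊥)
open import Data.Fin.Base using (Fin)
open import Data.Maybe.Base using (Maybe; maybe′)
open import Data.Nat.Base using (ℕ; zero; suc) renaming (_≤_ to _≤ᴺ_)
open import Data.Product.Base using (Σ-syntax; ∃-syntax; _×_; _,_; proj₁; proj₂)
open import Data.Sum.Base using (_⊎_)
open import Function.Base using (_on_)
open import Function.Definitions using (Congruent; Injective)
open import Induction.WellFounded using (WellFounded)
open import Level using (0ℓ; Lift)
open import Relation.Binary.Bundles using (Preorder; StrictPartialOrder)
open import Relation.Binary.Core using (Rel)
open import Relation.Binary.Morphism.Structures using (IsOrderIsomorphism)
open import Relation.Binary.PropositionalEquality.Core using (_≡_; _≢_)
open import Relation.Binary.Structures using (IsStrictTotalOrder)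
open import Relation.Nullary.Negation.Core using (¬_)
open import Relation.Unary using (Pred; _⊆_)

------------------------------------------------------------------------
-- The ground model: Aczel's iterative sets, with extensional equality.
-- It also serves to form canonical names for ground-model sets.

data V : Set₁ where
  set : (I : Set) → (I → V) → V

infix 4 _≐_

_≐_ : V → V → Set
set I x ≐ set J y = (∀ i → ∃[ j ] x i ≐ y j) × (∀ j → ∃[ i ] x i ≐ y j)

｛_,_｝ : V → V → V
｛ x , y ｝ = set Bool (λ b → if b then x else y)

-- Kuratowski pairs.
⟨_,_⟩ : V → V → V
⟨ x , y ⟩ = ｛ ｛ x , x ｝ , ｛ x , y ｝ ｝

∅ : V
∅ = set ⊥ (λ ())

-- x ∪ {x}
sucⱽ : V → V
sucⱽ x@(set I y) = set (Maybe I) (maybe′ y x)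

numeral : ℕ → V
numeral zero    = ∅
numeral (suc n) = sucⱽ (numeral n)

ω : V
ω = set ℕ numeral

------------------------------------------------------------------------
-- Well-orders; the trichotomy and the accessibility of every element are
-- classically the usual definition.  Ordinals are represented by well-orders, so that the
-- countable well-orders represent exactly the ordinals below ω₁.

record IsWellOrder {A : Set} (_≈_ _<_ : Rel A 0ℓ) : Set where
  field
    isStrictTotalOrder : IsStrictTotalOrder _≈_ _<_
    wellFounded        : WellFounded _<_

record WellOrder : Set₁ where
  field
    Carrier     : Set
    _≈_ _<_     : Rel Carrier 0ℓ
    isWellOrder : IsWellOrder _≈_ _<_

-- "At most countable": finite and empty sets are included.
Countable : {A : Set} → Rel A 0ℓ → Set
Countable {A} _≈_ =
  Σ[ f ∈ (A → ℕ) ] Congruent _≈_ _≡_ f × Injective _≈_ _≡_ f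

------------------------------------------------------------------------
-- Trees.

-- As in set theory, the nodes are themselves sets: `code` names the set
-- that a node is.  This is what lets the tree be viewed as an element
-- of V and hence be given a canonical name for the extension.
record Tree : Set₁ where
  field
    order : StrictPartialOrder 0ℓ 0ℓ 0ℓ

  open StrictPartialOrder order public
    using (_≈_; _<_) renaming (Carrier to Node)

  Below : Node → Set
  Below t = Σ[ s ∈ Node ] s < t

  field
    below-isWellOrder : ∀ t → IsWellOrder {Below t} (_≈_ on proj₁) (_<_ on proj₁)
    code              : Node → V
    code-cong         : Congruent _≈_ _≐_ code
    code-injective    : Injective _≈_ _≐_ code

  nodeSet : V
  nodeSet = set Node code

  orderSet : V
  orderSet = set (Σ[ s ∈ Node ] Σ[ t ∈ Node ] s < t)
                 (λ (s , t , _) → ⟨ code s , code t ⟩)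

module _ (T : Tree) where
  open Tree T

  OnLevel : WellOrder → Node → Set
  OnLevel α t = Σ[ g ∈ (Below t → α.Carrier) ]
      IsOrderIsomorphism (_≈_ on proj₁) α._≈_ (_<_ on proj₁) α._<_ g
    where module α = WellOrder α

  -- Every node has height below ω₁, and every level below ω₁ is non-empty.
  HasHeightω₁ : Set₁
  HasHeightω₁ =
    (∀ t → Countable {Below t} (_≈_ on proj₁)) ×
    (∀ (α : WellOrder) → Countable (WellOrder._≈_ α) → ∃[ t ] OnLevel α t)

  IsChain : Pred Node 0ℓ → Set
  IsChain C = ∀ {s t} → C s → C t → s < t ⊎ s ≈ t ⊎ t < s

  -- For trees of height ω₁.
  IsCofinalBranch : Pred Node 0ℓ → Set₁
  IsCofinalBranch C = IsChain C ×
    (∀ (α : WellOrder) → Countable (WellOrder._≈_ α) → ∃[ t ] C t × OnLevel α t)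

  HasCofinalBranch : Set₁
  HasCofinalBranch = ∃[ C ] IsCofinalBranch C

  Special : Set
  Special = Σ[ f ∈ (Node → ℕ) ]
    Congruent _≈_ _≡_ f × (∀ {s t} → s < t → f s ≢ f t)

------------------------------------------------------------------------
-- Forcing notions; p ≲ q reads "p is stronger than q".

ForcingNotion : Set₁
ForcingNotion = Preorder 0ℓ 0ℓ 0ℓ

module _ (ℙ : ForcingNotion) where
  open Preorder ℙ using (_≈_; _≲_) renaming (Carrier to Cond)

  Incompatible : Rel Cond 0ℓ
  Incompatible p q = ¬ (∃[ r ] r ≲ p × r ≲ q)

  IsAntichain : Pred Cond 0ℓ → Set
  IsAntichain A = ∀ {p q} → A p → A q → ¬ (p ≈ q) → Incompatible p q

  SizeAtMost : ℕ → Pred Cond 0ℓ → Set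
  SizeAtMost n A = ∀ m (x : Fin m → Cond) →
    (∀ i → A (x i)) → Injective _≡_ _≈_ x → m ≤ᴺ n

  σ-FiniteCC : Set₁
  σ-FiniteCC = Σ[ P ∈ (ℕ → Pred Cond 0ℓ) ]
    (∀ p → ∃[ k ] P k p) ×
    (∀ k → ∃[ n ] (∀ (A : Pred Cond 0ℓ) → A ⊆ P k → IsAntichain A → SizeAtMost n A))

------------------------------------------------------------------------
-- The forcing language and the forcing relation.

module Forcing (ℙ : ForcingNotion) where
  open Preorder ℙ using (_≲_) renaming (Carrier to Cond)

  -- `name I p τ` is the name {(τ i , p i) : i ∈ I}.
  data Name : Set₁ where
    name : (I : Set) → (I → Cond) → (I → Name) → Name

  -- Since ℙ need not have a largest element, every condition is attached
  -- to every element: x̌ = {(y̌ , p) : y ∈ x, p ∈ ℙ}.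
  check : V → Name
  check (set I x) = name (I × Cond) proj₂ (λ (i , _) → check (x i))

  -- Formulas with names as parameters.  A bound variable is represented by
  -- a function on names, so quantifiers range over all names.
  infix  8 _≐̇_ _∈̇_
  infix  7 ¬̇_
  infixr 6 _∧̇_
  infixr 5 _∨̇_
  infixr 4 _⇒̇_ _⇔̇_

  data Formula : Set₁ where
    _≐̇_ _∈̇_        : Name → Name → Formula
    ¬̇_             : Formula → Formula
    _∧̇_ _∨̇_ _⇒̇_    : Formula → Formula → Formula
    ∀̇ ∃̇            : (Name → Formula) → Formula

  DenseBelow : ∀ {ℓ} → Cond → Pred Cond ℓ → Set ℓ
  DenseBelow p D = ∀ q → q ≲ p → ∃[ r ] r ≲ q × D r

  -- p forces a = b iff every q ≤ p lying below the condition attached to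
  -- an element of one of a, b forces that element to belong to the other.
  _⊩≐[_,_] : Cond → Name → Name → Set
  p ⊩≐[ name I c a , name J d b ] =
    (∀ i q → q ≲ p → q ≲ c i → DenseBelow q (λ r → ∃[ j ] r ≲ d j × r ⊩≐[ a i , b j ])) ×
    (∀ j q → q ≲ p → q ≲ d j → DenseBelow q (λ r → ∃[ i ] r ≲ c i × r ⊩≐[ a i , b j ]))

  _⊩∈[_,_] : Cond → Name → Name → Set
  p ⊩∈[ a , name J d b ] = DenseBelow p (λ r → ∃[ j ] r ≲ d j × r ⊩≐[ a , b j ])

  infix 3 _⊩_ ⊩_

  -- Existential and disjunctive clauses ask only for density, so every
  -- formula is forced by p as soon as it is forced densely below p.
  _⊩_ : Cond → Formula → Set₁
  p ⊩ a ≐̇ b = Lift _ (p ⊩≐[ a , b ])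
  p ⊩ a ∈̇ b = Lift _ (p ⊩∈[ a , b ])
  p ⊩ ¬̇ φ   = ∀ q → q ≲ p → ¬ (q ⊩ φ)
  p ⊩ φ ∧̇ ψ = p ⊩ φ × p ⊩ ψ
  p ⊩ φ ∨̇ ψ = DenseBelow p (λ r → r ⊩ φ ⊎ r ⊩ ψ)
  p ⊩ φ ⇒̇ ψ = ∀ q → q ≲ p → q ⊩ φ → q ⊩ ψ
  p ⊩ ∀̇ φ   = ∀ a → p ⊩ φ a
  p ⊩ ∃̇ φ   = DenseBelow p (λ r → ∃[ a ] r ⊩ φ a)

  -- φ holds in V[G] for every ℙ-generic G, i.e. φ is forced by every
  -- condition (by the largest one, if there is one).
  ⊩_ : Formula → Set₁
  ⊩ φ = ∀ p → p ⊩ φ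

  _⇔̇_ : Formula → Formula → Formula
  φ ⇔̇ ψ = (φ ⇒̇ ψ) ∧̇ (ψ ⇒̇ φ)

  ∀∈ ∃∈ : Name → (Name → Formula) → Formula
  ∀∈ a φ = ∀̇ λ x → x ∈̇ a ⇒̇ φ x
  ∃∈ a φ = ∃̇ λ x → x ∈̇ a ∧̇ φ x

  -- z = {x , y}
  isUnorderedPair : (z x y : Name) → Formula
  isUnorderedPair z x y = ∀̇ λ w → w ∈̇ z ⇔̇ w ≐̇ x ∨̇ w ≐̇ y

  -- z = {{x} , {x , y}}
  isPair : (z x y : Name) → Formula
  isPair z x y = ∃̇ λ u → ∃̇ λ v →
    isUnorderedPair u x x ∧̇ isUnorderedPair v x y ∧̇ isUnorderedPair z u v

  infix 8 ⟨_,_⟩∈̇_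

  ⟨_,_⟩∈̇_ : (x y r : Name) → Formula
  ⟨ x , y ⟩∈̇ r = ∃∈ r λ z → isPair z x y

  isFunction : (f A B : Name) → Formula
  isFunction f A B =
    (∀∈ f λ z → ∃∈ A λ x → ∃∈ B λ y → isPair z x y) ∧̇
    (∀∈ A λ x → ∃∈ B λ y → ⟨ x , y ⟩∈̇ f) ∧̇
    (∀̇ λ x → ∀̇ λ y → ∀̇ λ y′ → ⟨ x , y ⟩∈̇ f ∧̇ ⟨ x , y′ ⟩∈̇ f ⇒̇ y ≐̇ y′)

  -- Some f : A → ω is injective on chains of (A , R); ω is absolute, so
  -- check ω names the ω of the extension.
  isSpecial : (A R : Name) → Formula
  isSpecial A R = ∃̇ λ f → isFunction f A (check ω) ∧̇
    (∀∈ A λ s → ∀∈ A λ t → ⟨ s , t ⟩∈̇ R ⇒̇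
      (∀̇ λ m → ∀̇ λ n → ⟨ s , m ⟩∈̇ f ∧̇ ⟨ t , n ⟩∈̇ f ⇒̇ ¬̇ m ≐̇ n))

  NonSpecialInExtension : Tree → Set₁
  NonSpecialInExtension T = ⊩ ¬̇ isSpecial (check (Tree.nodeSet T)) (check (Tree.orderSet T))

{-# OPTIONS --safe #-}

-- Suppose r forces ḟ to specialise T.  For each node t pick p_t ≤ r in some
-- piece P_k of ℙ deciding ḟ(t) = n, and label t by the pair (k , n).  If s < t
-- have the same label then p_s and p_t are incompatible, since a common
-- extension would force ḟ(s) = ḟ(t).  Hence the p_t along a chain with constant
-- label (k , n) form an antichain in P_k, so such chains have length at most n_k.
-- Label together with the rank inside the label class then specialises T in the
-- ground model.

module Submission where

open import Defs
open import Axiom.ExcludedMiddle using (ExcludedMiddle)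
open import Data.Bool.Base using (true; false)
open import Data.Fin.Base as Fin using (Fin)
open import Data.Fin.Properties as Fin using ()
open import Data.Nat.Base using (ℕ; zero; suc; _*_; _≤_; _<_; s≤s)
open import Data.Nat.Properties
  using (≤-antisym; ≤-pred; <-irrefl; ≮⇒≥; even≢odd;
         *-cancelˡ-≡; suc-injective)
open import Data.Nat.Induction using (<-rec)
open import Data.Product.Base using (Σ-syntax; ∃-syntax; _×_; _,_; proj₁; proj₂)
open import Data.Sum.Base using (_⊎_; inj₁; inj₂)
open import Data.Unit.Base using (⊤; tt)
open import Function.Definitions using (Congruent; Injective)
open import Level using (Level; 0ℓ; lift)
open import Relation.Binary.Bundles using (Preorder; StrictPartialOrder)
open import Relation.Binary.Definitions using (tri<; tri≈; tri>)
open import Relation.Binary.PropositionalEquality.Core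
  using (_≡_; refl; sym; trans; cong)
open import Relation.Nullary.Decidable.Core using (yes; no)
open import Relation.Nullary.Negation.Core using (¬_; contradiction)
open import Relation.Unary using (Pred)

-- Coding pairs of numbers, and least witnesses.

-- 2ᵃ(2b + 1)
pair : ℕ → ℕ → ℕ
pair zero    b = suc (2 * b)
pair (suc a) b = 2 * pair a b

-- Parity tells whether the first component is zero; if neither is, halve both sides and recurse.
pair-injective : ∀ a b a′ b′ → pair a b ≡ pair a′ b′ → a ≡ a′ × b ≡ b′
pair-injective zero    b zero     b′ eq = refl , *-cancelˡ-≡ b b′ 2 (suc-injective eq)
pair-injective zero    b (suc a′) b′ eq = contradiction (sym eq) (even≢odd (pair a′ b′) b)
pair-injective (suc a) b zero     b′ eq = contradiction eq (even≢odd (pair a b) b′)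
pair-injective (suc a) b (suc a′) b′ eq
  with refl , refl ← pair-injective a b a′ b′ (*-cancelˡ-≡ (pair a b) (pair a′ b′) 2 eq)
  = refl , refl

module _ {ℓ : Level} where
  IsLeast : Pred ℕ ℓ → ℕ → Set ℓ
  IsLeast P n = P n × (∀ m → P m → n ≤ m)

  least : ExcludedMiddle ℓ → (P : Pred ℕ ℓ) → ∃[ n ] P n → ∃[ n ] IsLeast P n
  least em P (n , Pn) = <-rec (λ n → P n → ∃[ n ] IsLeast P n) step n Pn
    where
    step : ∀ n → (∀ {m} → m < n → P m → ∃[ n ] IsLeast P n) → P n → ∃[ n ] IsLeast P n
    step n rec Pn with em {Σ[ m ∈ ℕ ] Σ[ _ ∈ m < n ] P m}
    ... | yes (m , m<n , Pm) = rec m<n Pm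
    ... | no  none = n , Pn , λ m Pm → ≮⇒≥ (λ m<n → none (m , m<n , Pm))

  -- Picking least witnesses of equivalent predicates makes the choice independent of the
  -- representative. This is how `rank` and `label` come to respect `≈`.
  least-unique : ∀ {P Q : Pred ℕ ℓ} → (∀ {n} → P n → Q n) → (∀ {n} → Q n → P n) →
                 ∀ {m n} → IsLeast P m → IsLeast Q n → m ≡ n
  least-unique P⇒Q Q⇒P {m} {n} (Pm , m≤) (Qn , n≤) =
    ≤-antisym (m≤ n (Q⇒P Qn)) (n≤ m (P⇒Q Pm))

-- Chains of constant label in the tree.

module _ (T : Tree) where
  open Tree T renaming (_<_ to _<ᵀ_)
  private module O = StrictPartialOrder order

  module Monochromatic (label : Node → ℕ) where
    -- A chain is listed downwards, starting next to `t` but not counting `t`, so larger indices are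
    -- lower in the tree.
    Chain : ℕ → Node → Set
    Chain zero    t = ⊤
    Chain (suc m) t = Σ[ s ∈ Node ] s <ᵀ t × label s ≡ label t × Chain m s

    node : ∀ m {t} → Chain m t → Fin m → Node
    node (suc m) (s , _ , _ , c) Fin.zero    = s
    node (suc m) (s , _ , _ , c) (Fin.suc i) = node m c i

    node-label : ∀ m {t} (c : Chain m t) i → label (node m c i) ≡ label t
    node-label (suc m) (s , _ , eq , c) Fin.zero    = eq
    node-label (suc m) (s , _ , eq , c) (Fin.suc i) = trans (node-label m c i) eq

    node-below : ∀ m {t} (c : Chain m t) i → node m c i <ᵀ t
    node-below (suc m) (s , s<t , _ , c) Fin.zero    = s<t
    node-below (suc m) (s , s<t , _ , c) (Fin.suc i) = O.trans (node-below m c i) s<t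

    node-decreasing : ∀ m {t} (c : Chain m t) {i j} → i Fin.< j → node m c j <ᵀ node m c i
    node-decreasing (suc m) (_ , _ , _ , c) {Fin.zero}  {Fin.suc j} _   = node-below m c j
    node-decreasing (suc m) (_ , _ , _ , c) {Fin.suc i} {Fin.suc j} i<j =
      node-decreasing m c (≤-pred i<j)

    module _ (label-cong : Congruent _≈_ _≡_ label) where
      Chain-resp-≈ : ∀ m {s t} → s ≈ t → Chain m s → Chain m t
      Chain-resp-≈ zero    s≈t _ = tt
      Chain-resp-≈ (suc m) s≈t (u , u<s , eq , c) =
        u , O.<-respʳ-≈ s≈t u<s , trans eq (label-cong s≈t) , c

      bounded⇒special : ExcludedMiddle 0ℓ →
                        (∀ t → ∃[ n ] ∀ m → Chain m t → m ≤ n) → Special T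
      bounded⇒special em bounded = colour , colour-cong , colour-injective
        where
        -- The least length that is not attained is one more than the greatest attained length. The
        -- bound `n` shows that `suc n` is not attained.
        height : ∀ t → ∃[ n ] IsLeast (λ m → ¬ Chain m t) n
        height t = let n , b = bounded t in
          least em _ (suc n , λ c → <-irrefl refl (b (suc n) c))

        rank : Node → ℕ
        rank t = proj₁ (height t)

        rank-cong : Congruent _≈_ _≡_ rank
        rank-cong {s} {t} s≈t = least-unique
          (λ ¬c c → ¬c (Chain-resp-≈ _ (O.Eq.sym s≈t) c))
          (λ ¬c c → ¬c (Chain-resp-≈ _ s≈t c))
          (proj₂ (height s)) (proj₂ (height t))

        -- Putting `s` on top of a chain below `s` gives a chain below `t` that is longer by one.
        -- The empty chain always exists, so `rank t` is never zero.
        rank-mono : ∀ {s t} → s <ᵀ t → label s ≡ label t → rank s < rank t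
        rank-mono {s} {t} s<t eq with height t
        ... | zero  , ¬c , _ = contradiction tt ¬c
        ... | suc m , ¬c , _ =
          s≤s (proj₂ (proj₂ (height s)) m (λ c → ¬c (s , s<t , eq , c)))

        colour : Node → ℕ
        colour t = pair (label t) (rank t)

        colour-cong : Congruent _≈_ _≡_ colour
        colour-cong s≈t rewrite label-cong s≈t | rank-cong s≈t = refl

        colour-injective : ∀ {s t} → s <ᵀ t → ¬ (colour s ≡ colour t)
        colour-injective {s} {t} s<t eq =
          let eqˡ , eqʳ = pair-injective (label s) (rank s) (label t) (rank t) eq
          in <-irrefl eqʳ (rank-mono s<t eqˡ)

-- General facts about the forcing relation and canonical names.

module ForcingProperties (ℙ : ForcingNotion) where
  open Forcing ℙ
  open Preorder ℙ using (_≲_) renaming (Carrier to Cond; refl to ≲-refl; trans to ≲-trans)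

  DenseBelow-mono : ∀ {ℓ} {D : Pred Cond ℓ} {p q} → q ≲ p → DenseBelow p D → DenseBelow q D
  DenseBelow-mono q≲p dense r r≲q = dense r (≲-trans r≲q q≲p)

  ⊩≐-mono : ∀ a b {p q} → q ≲ p → p ⊩≐[ a , b ] → q ⊩≐[ a , b ]
  ⊩≐-mono (name _ _ _) (name _ _ _) q≲p (fwd , bwd) =
    (λ i r r≲q → fwd i r (≲-trans r≲q q≲p)) , (λ j r r≲q → bwd j r (≲-trans r≲q q≲p))

  ⊩≐-refl : ∀ a {p} → p ⊩≐[ a , a ]
  ⊩≐-refl (name I c a) =
    (λ i q _ q≲c r r≲q → r , ≲-refl , i , ≲-trans r≲q q≲c , ⊩≐-refl (a i)) ,
    (λ i q _ q≲c r r≲q → r , ≲-refl , i , ≲-trans r≲q q≲c , ⊩≐-refl (a i))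

  ⊩≐-sym : ∀ a b {p} → p ⊩≐[ a , b ] → p ⊩≐[ b , a ]
  ⊩≐-sym (name I c a) (name J d b) (fwd , bwd) =
    (λ j q q≲p q≲d r r≲q →
      let s , s≲r , i , s≲c , e = bwd j q q≲p q≲d r r≲q
      in s , s≲r , i , s≲c , ⊩≐-sym (a i) (b j) e) ,
    (λ i q q≲p q≲c r r≲q →
      let s , s≲r , j , s≲d , e = fwd i q q≲p q≲c r r≲q
      in s , s≲r , j , s≲d , ⊩≐-sym (a i) (b j) e)

  -- An element is matched through the middle name in two successive extensions; the first match is
  -- carried down to the second condition by monotonicity.
  ⊩≐-trans : ∀ a b c {p} → p ⊩≐[ a , b ] → p ⊩≐[ b , c ] → p ⊩≐[ a , c ]
  ⊩≐-trans (name I c a) (name J d b) (name K e x) (ab , ba) (bc , cb) =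
    (λ i q q≲p q≲c r r≲q →
      let s , s≲r , j , s≲d , eq  = ab i q q≲p q≲c r r≲q
          s≲p                     = ≲-trans s≲r (≲-trans r≲q q≲p)
          u , u≲s , k , u≲e , eq′ = bc j s s≲p s≲d s ≲-refl
      in u , ≲-trans u≲s s≲r , k , u≲e ,
         ⊩≐-trans (a i) (b j) (x k) (⊩≐-mono (a i) (b j) u≲s eq) eq′) ,
    (λ k q q≲p q≲e r r≲q →
      let s , s≲r , j , s≲d , eq  = cb k q q≲p q≲e r r≲q
          s≲p                     = ≲-trans s≲r (≲-trans r≲q q≲p)
          u , u≲s , i , u≲c , eq′ = ba j s s≲p s≲d s ≲-refl
      in u , ≲-trans u≲s s≲r , i , u≲c ,
         ⊩≐-trans (a i) (b j) (x k) eq′ (⊩≐-mono (b j) (x k) u≲s eq))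

  -- Only conjunction and `∀̇` need the induction hypothesis. Every other clause already quantifies
  -- over all stronger conditions, so transitivity of `≲` is enough.
  ⊩-mono : ∀ φ {p q} → q ≲ p → p ⊩ φ → q ⊩ φ
  ⊩-mono (a ≐̇ b)            q≲p (lift h) = lift (⊩≐-mono a b q≲p h)
  ⊩-mono (a ∈̇ name _ _ _)   q≲p (lift h) = lift (DenseBelow-mono q≲p h)
  ⊩-mono (¬̇ φ)              q≲p h        = λ r r≲q → h r (≲-trans r≲q q≲p)
  ⊩-mono (φ ∧̇ ψ)            q≲p (h , k)  = ⊩-mono φ q≲p h , ⊩-mono ψ q≲p k
  ⊩-mono (φ ∨̇ ψ)            q≲p h        = DenseBelow-mono q≲p h
  ⊩-mono (φ ⇒̇ ψ)            q≲p h        = λ r r≲q → h r (≲-trans r≲q q≲p)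
  ⊩-mono (∀̇ φ)              q≲p h        = λ a → ⊩-mono (φ a) q≲p (h a)
  ⊩-mono (∃̇ φ)              q≲p h        = DenseBelow-mono q≲p h

  -- `check` attaches every condition to every element, so the index `(i , q)` is available at
  -- whichever `q` is reached.
  ⊩check-∈ : ∀ {I} (x : I → V) i → ⊩ check (x i) ∈̇ check (set I x)
  ⊩check-∈ x i p = lift λ q q≲p → q , ≲-refl , (i , q) , ≲-refl , ⊩≐-refl (check (x i))

  ⊩check-unorderedPair : ∀ x y → ⊩ isUnorderedPair (check ｛ x , y ｝) (check x) (check y)
  ⊩check-unorderedPair x y p w =
    (λ q q≲p (lift w∈) r r≲q → split (w∈ r r≲q)) ,
    (λ q q≲p w≐ → lift λ r r≲q → unsplit (w≐ r r≲q))
    where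
    split : ∀ {r} → _ → ∃[ s ] s ≲ r × (s ⊩ w ≐̇ check x ⊎ s ⊩ w ≐̇ check y)
    split (s , s≲r , (true  , _) , _ , e) = s , s≲r , inj₁ (lift e)
    split (s , s≲r , (false , _) , _ , e) = s , s≲r , inj₂ (lift e)

    unsplit : ∀ {r} → ∃[ s ] s ≲ r × (s ⊩ w ≐̇ check x ⊎ s ⊩ w ≐̇ check y) → _
    unsplit (s , s≲r , inj₁ (lift e)) = s , s≲r , (true  , s) , ≲-refl , e
    unsplit (s , s≲r , inj₂ (lift e)) = s , s≲r , (false , s) , ≲-refl , e

  ⊩check-pair : ∀ x y → ⊩ isPair (check ⟨ x , y ⟩) (check x) (check y)
  ⊩check-pair x y p q _ =
    q , ≲-refl , check ｛ x , x ｝ , λ r _ →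
    r , ≲-refl , check ｛ x , y ｝ ,
    ⊩check-unorderedPair x x r ,
    ⊩check-unorderedPair x y r ,
    ⊩check-unorderedPair ｛ x , x ｝ ｛ x , y ｝ r

  -- Deciding values of a name for a specialising function.

  module _ (T : Tree) where
    open Tree T using (Node; code; nodeSet; orderSet) renaming (_<_ to _<ᵀ_)

    ⊩check-node : ∀ t → ⊩ check (code t) ∈̇ check nodeSet
    ⊩check-node = ⊩check-∈ code

    ⊩check-order : ∀ {s t} → s <ᵀ t → ⊩ ⟨ check (code s) , check (code t) ⟩∈̇ check orderSet
    ⊩check-order {s} {t} s<t p q _ =
      q , ≲-refl , check ⟨ code s , code t ⟩ ,
      ⊩check-∈ (λ (s , t , _) → ⟨ code s , code t ⟩) (s , t , s<t) q , ⊩check-pair (code s) (code t) q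

    -- The value is mediated by a name `y` merely forced equal to the numeral. This avoids
    -- substituting equal names inside `⟨_,_⟩∈̇_`; transitivity of forced equality suffices later.
    Decides : Name → Cond → Node → ℕ → Set₁
    Decides f p t n = Σ[ y ∈ Name ] p ⊩ ⟨ check (code t) , y ⟩∈̇ f × p ⊩ y ≐̇ check (numeral n)

    module Specialising {r f}
      (fun : r ⊩ isFunction f (check nodeSet) (check ω))
      (inj : r ⊩ ∀∈ (check nodeSet) λ s → ∀∈ (check nodeSet) λ t →
               ⟨ s , t ⟩∈̇ check orderSet ⇒̇
               (∀̇ λ m → ∀̇ λ n → ⟨ s , m ⟩∈̇ f ∧̇ ⟨ t , n ⟩∈̇ f ⇒̇ ¬̇ m ≐̇ n))
      where

      decide : ∀ t → ∃[ p ] p ≲ r × ∃[ n ] Decides f p t n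
      decide t =
        -- Totality of `f` gives a value `y` forced into `check ω` by some `q`; a further extension
        -- `p` settles which numeral it is.
        let q , q≲r , y , lift y∈ω , pair∈f =
              proj₁ (proj₂ fun) (check (code t)) r ≲-refl (⊩check-node t r) r ≲-refl
            p , p≲q , (n , _) , _ , e = y∈ω q ≲-refl
        in p , ≲-trans p≲q q≲r , n , y ,
           ⊩-mono (⟨ check (code t) , y ⟩∈̇ f) p≲q pair∈f , lift e

      decides-same⇒incompatible : ∀ {s t p q n} → s <ᵀ t → p ≲ r →
        Decides f p s n → Decides f q t n → Incompatible ℙ p q
      decides-same⇒incompatible {s} {t} {n = n} s<t p≲r (y , fs , lift y≐n) (z , ft , lift z≐n)
        (u , u≲p , u≲q) =
        -- Every nested implication is evaluated at the common extension `u`, which is below `r`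
        -- through `p`. The last argument, `y` = `ň` = `z`, contradicts the forced inequality.
        inj š u u≲r (⊩check-node s u) ť u ≲-refl (⊩check-node t u)
            u ≲-refl (⊩check-order s<t u) y z
            u ≲-refl (⊩-mono (⟨ š , y ⟩∈̇ f) u≲p fs , ⊩-mono (⟨ ť , z ⟩∈̇ f) u≲q ft)
            u ≲-refl
            (lift (⊩≐-trans y ň z (⊩≐-mono y ň u≲p y≐n) (⊩≐-sym z ň (⊩≐-mono z ň u≲q z≐n))))
        where
        š = check (code s)
        ť = check (code t)
        ň = check (numeral n)
        u≲r = ≲-trans u≲p p≲r

-- Labelling nodes by pieces of the forcing notion and decided values.

module _ (em : ∀ {ℓ} → ExcludedMiddle ℓ) (ℙ : ForcingNotion)
         (σ : σ-FiniteCC ℙ) (T : Tree) where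
  open Forcing ℙ
  open ForcingProperties ℙ
  open Preorder ℙ using (_≲_) renaming (Carrier to Cond; refl to ≲-refl)
  open Tree T using (Node; _≈_; order) renaming (_<_ to _<ᵀ_)
  private
    module ℙ = Preorder ℙ
    module O = StrictPartialOrder order
    Piece  = proj₁ σ
    cover  = proj₁ (proj₂ σ)
    finite = proj₂ (proj₂ σ)

  incompatible-sym : ∀ {p q} → Incompatible ℙ p q → Incompatible ℙ q p
  incompatible-sym p⊥q (u , u≲q , u≲p) = p⊥q (u , u≲p , u≲q)

  incompatible⇒≉ : ∀ {p q} → Incompatible ℙ p q → ¬ (p ℙ.≈ q)
  incompatible⇒≉ p⊥q p≈q = p⊥q (_ , ≲-refl , ℙ.reflexive p≈q)

  -- The range of `x` is an antichain inside `Piece k`, and `x` is injective because `≈`-equal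
  -- conditions are compatible.
  pairwise-incompatible⇒bounded : ∀ k {m} (x : Fin m → Cond) → (∀ i → Piece k (x i)) →
    (∀ {i j} → i Fin.< j → Incompatible ℙ (x i) (x j)) → m ≤ proj₁ (finite k)
  pairwise-incompatible⇒bounded k {m} x x∈ x⊥ =
    proj₂ (finite k) (λ p → ∃[ i ] p ≡ x i) (λ { (i , refl) → x∈ i }) antichain
      m x (λ i → i , refl) injective
    where
    antichain : IsAntichain ℙ (λ p → ∃[ i ] p ≡ x i)
    antichain (i , refl) (j , refl) x≉ with Fin.<-cmp i j
    ... | tri< i<j _ _  = x⊥ i<j
    ... | tri≈ _ refl _ = contradiction ℙ.Eq.refl x≉
    ... | tri> _ _ j<i  = incompatible-sym (x⊥ j<i)

    injective : Injective _≡_ ℙ._≈_ x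
    injective {i} {j} x≈ with Fin.<-cmp i j
    ... | tri< i<j _ _ = contradiction x≈ (incompatible⇒≉ (x⊥ i<j))
    ... | tri≈ _ eq _  = eq
    ... | tri> _ _ j<i = contradiction (ℙ.Eq.sym x≈) (incompatible⇒≉ (x⊥ j<i))

  forces-special⇒special : ∀ {p} →
    p ⊩ isSpecial (check (Tree.nodeSet T)) (check (Tree.orderSet T)) → Special T
  forces-special⇒special {p} forced with forced p ≲-refl
  ... | r , _ , f , fun , inj = bounded⇒special label-cong em bounded
    where
    open Specialising T fun inj

    -- Closed under ≈, so that the least label of a node is a congruence.
    HasLabel : Node → ℕ → Set₁
    HasLabel t c = Σ[ t′ ∈ Node ] t′ ≈ t × Σ[ k ∈ ℕ ] Σ[ n ∈ ℕ ] pair k n ≡ c ×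
      Σ[ p ∈ Cond ] p ≲ r × Piece k p × Decides T f p t′ n

    HasLabel-resp-≈ : ∀ {s t c} → s ≈ t → HasLabel s c → HasLabel t c
    HasLabel-resp-≈ s≈t (s′ , s′≈s , h) = s′ , O.Eq.trans s′≈s s≈t , h

    labelled : ∀ t → ∃[ c ] IsLeast (HasLabel t) c
    labelled t =
      let p , p≲r , n , d = decide t
          k , p∈          = cover p
      in least em (HasLabel t)
           (pair k n , t , O.Eq.refl , k , n , refl , p , p≲r , p∈ , d)

    label : Node → ℕ
    label t = proj₁ (labelled t)

    label-cong : Congruent _≈_ _≡_ label
    label-cong {s} {t} s≈t =
      least-unique (HasLabel-resp-≈ s≈t) (HasLabel-resp-≈ (O.Eq.sym s≈t))
        (proj₂ (labelled s)) (proj₂ (labelled t))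

    open Monochromatic T label

    -- Injectivity of `pair` recovers the piece and the value from the label, so all nodes of one
    -- label share `k` and `n`; only the representative and the condition vary.
    witness : ∀ {t k n} → label t ≡ pair k n →
      Σ[ t′ ∈ Node ] t′ ≈ t × Σ[ p ∈ Cond ] p ≲ r × Piece k p × Decides T f p t′ n
    witness {t} {k} {n} eq with labelled t
    ... | c , (t′ , t′≈t , k′ , n′ , eq′ , h) , _
      with refl , refl ← pair-injective k′ n′ k n (trans eq′ eq) = t′ , t′≈t , h

    bounded : ∀ t → ∃[ N ] ∀ m → Chain m t → m ≤ N
    -- The equation `eq` is kept so that the decomposition `pair k n` of the label of `t` passes to
    -- every node of the chain.
    bounded t with labelled t in eq
    ... | c , (_ , _ , k , n , refl , _) , _ = proj₁ (finite k) , λ m ch →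
      let w : ∀ i → _
          w i = witness {node m ch i} {k} {n} (trans (node-label m ch i) (cong proj₁ eq))
      in pairwise-incompatible⇒bounded k
           (λ i → proj₁ (proj₂ (proj₂ (w i))))
           (λ i → proj₁ (proj₂ (proj₂ (proj₂ (proj₂ (w i))))))
           (λ {i} {j} i<j →
             let _ , ≈i , _ , _ , _ , di   = w i
                 _ , ≈j , _ , p≲r , _ , dj = w j
             -- For `i < j` the `j`-th node is the lower one, hence the swap. Its order relation to
             -- the `i`-th node is moved to the `≈`-representatives whose values the conditions
             -- decide.
             in incompatible-sym (decides-same⇒incompatible {n = n}
                  (O.<-respʳ-≈ (O.Eq.sym ≈i)
                    (O.<-respˡ-≈ (O.Eq.sym ≈j) (node-decreasing m ch i<j)))
                  p≲r dj di))

theorem3p3 : (∀ {ℓ} → ExcludedMiddle ℓ) →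
    (ℙ : ForcingNotion) → σ-FiniteCC ℙ →
    (T : Tree) → HasHeightω₁ T → ¬ Special T → ¬ HasCofinalBranch T →
    Forcing.NonSpecialInExtension ℙ T
-- By the clause for `¬̇`, it remains to refute that some condition forces `isSpecial`.
theorem3p3 em ℙ σ T _ ¬special _ _ _ _ forced =
  ¬special (forces-special⇒special em ℙ σ T forced)
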